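{- The logic $\mathbf{Grz}$ enjoys the uniform Lyndon interpolation property. Moreover, for any formula $\varphi$ and any finite sets $P,Q$ of propositional variables there exists a uniform Lyndon interpolant $\theta$ of $(\varphi,P,Q)$ in $\mathbf{Grz}$ with $d(\theta)\le 3n(\varphi)+3$.
   Context: Formulas are built from countably many propositional variables, $\bot$, $\to$ and $\Box$ (other connectives are abbreviations). Modal depth: $d(p)=d(\bot)=0$, $d(\varphi\to\psi)=\max\{d(\varphi),d(\psi)\}$, $d(\Box\varphi)=d(\varphi)+1$. Positive/negative variable sets: $v^+(p)=\{p\}$, $v^-(p)=\emptyset$; $v^\pm(\bot)=\emptyset$; $v^+(\psi\to\theta)=v^-(\psi)\cup v^+(\theta)$, $v^-(\psi\to\theta)=v^+(\psi)\cup v^-(\theta)$; $v^\pm(\Box\psi)=v^\pm(\psi)$. $\mathrm{Sub}(\varphi)$ is the set of subformulas of $\varphi$ and $n(\varphi)=|\{\psi:\Box\psi\in\mathrm{Sub}(\varphi)\}|$. A normal logic is a set of formulas containing all tautologies and $\Box(p\to q)\to(\Box p\to\Box q)$, closed under modus ponens, necessitation and uniform substitution; $L\vdash\varphi$ means $\varphi\in L$. $\mathbf{Grz}$ is the least normal logic containing $\Box(\Box(p\to\Box p)\to p)\to p$. For a normal logic $L$, formula $\varphi$ and finite sets $P,Q$ of variables, a uniform Lyndon interpolant of $(\varphi,P,Q)$ in $L$ is a formula $\theta$ with $v^+(\theta)\subseteq v^+(\varphi)\setminus P$, $v^-(\theta)\subseteq v^-(\varphi)\setminus Q$, $L\vdash\varphi\to\theta$,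 and such that $L\vdash\theta\to\psi$ for every $\psi$ with $v^+(\psi)\cap P=v^-(\psi)\cap Q=\emptyset$ and $L\vdash\varphi\to\psi$. $L$ enjoys the uniform Lyndon interpolation property if such an interpolant exists for all $\varphi,P,Q$. -}

module Defs where

open import Data.Nat using (ℕ; zero; suc; _⊔_; _≡ᵇ_)
open import Data.Bool using (Bool; true; false; _∧_; _∨_; not)
open import Data.List using (List; []; _∷_; _++_; length; deduplicateᵇ)
open import Data.List.Membership.Propositional using (_∈_; _∉_)
open import Data.Product using (_×_; Σ)
open import Relation.Binary.PropositionalEquality using (_≡_)

data Fm : Set where
  var  : ℕ → Fm
  ⊥'   : Fm
  _⇒_  : Fm → Fm → Fm
  □_   : Fm → Fm

infixr 5 _⇒_
infix 6 □_

¬' : Fm → Fm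
¬' φ = φ ⇒ ⊥'

◇_ : Fm → Fm
◇ φ = ¬' (□ (¬' φ))

d : Fm → ℕ
d (var _) = 0
d ⊥' = 0
d (φ ⇒ ψ) = d φ ⊔ d ψ
d (□ φ) = suc (d φ)

mutual
  v⁺ : Fm → List ℕ
  v⁺ (var p) = p ∷ []
  v⁺ ⊥' = []
  v⁺ (ψ ⇒ θ) = v⁻ ψ ++ v⁺ θ
  v⁺ (□ ψ) = v⁺ ψ

  v⁻ : Fm → List ℕ
  v⁻ (var p) = []
  v⁻ ⊥' = []
  v⁻ (ψ ⇒ θ) = v⁺ ψ ++ v⁻ θ
  v⁻ (□ ψ) = v⁻ ψ

_==_ : Fm → Fm → Bool
var p == var q = p ≡ᵇ q
⊥' == ⊥' = true
(a ⇒ b) == (c ⇒ e) = (a == c) ∧ (b == e)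
(□ a) == (□ b) = a == b
_ == _ = false

boxedSubs : Fm → List Fm
boxedSubs (var _) = []
boxedSubs ⊥' = []
boxedSubs (φ ⇒ ψ) = boxedSubs φ ++ boxedSubs ψ
boxedSubs (□ φ) = φ ∷ boxedSubs φ

n : Fm → ℕ
n φ = length (deduplicateᵇ _==_ (boxedSubs φ))

eval : (Fm → Bool) → Fm → Bool
eval V (var p) = V (var p)
eval V ⊥' = false
eval V (φ ⇒ ψ) = not (eval V φ) ∨ eval V ψ
eval V (□ φ) = V (□ φ)

-- tautologies (of the modal language, i.e. instances of propositional tautologies)
Taut : Fm → Set
Taut φ = (V : Fm → Bool) → eval V φ ≡ true

subst : (ℕ → Fm) → Fm → Fm
subst σ (var p) = σ p
subst σ ⊥' = ⊥'
subst σ (φ ⇒ ψ) = subst σ φ ⇒ subst σ ψ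
subst σ (□ φ) = □ subst σ φ

p₀ q₀ : Fm
p₀ = var 0
q₀ = var 1

axK : Fm
axK = □ (p₀ ⇒ q₀) ⇒ (□ p₀ ⇒ □ q₀)

axGrz : Fm
axGrz = □ (□ (p₀ ⇒ □ p₀) ⇒ p₀) ⇒ p₀

data Grz⊢_ : Fm → Set where
  taut : ∀ {φ} → Taut φ → Grz⊢ φ
  k    : Grz⊢ axK
  grz  : Grz⊢ axGrz
  mp   : ∀ {φ ψ} → Grz⊢ (φ ⇒ ψ) → Grz⊢ φ → Grz⊢ ψ
  nec  : ∀ {φ} → Grz⊢ φ → Grz⊢ (□ φ)
  us   : ∀ {φ} (σ : ℕ → Fm) → Grz⊢ φ → Grz⊢ subst σ φ

IsULI : Fm → List ℕ → List ℕ → Fm → Set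
IsULI φ P Q θ =
  (∀ {x} → x ∈ v⁺ θ → x ∈ v⁺ φ × x ∉ P) ×
  (∀ {x} → x ∈ v⁻ θ → x ∈ v⁻ φ × x ∉ Q) ×
  (Grz⊢ (φ ⇒ θ)) ×
  (∀ ψ → (∀ {x} → x ∈ v⁺ ψ → x ∉ P) → (∀ {x} → x ∈ v⁻ ψ → x ∉ Q) →
     Grz⊢ (φ ⇒ ψ) → Grz⊢ (θ ⇒ ψ))

GrzULIP : Set
GrzULIP = ∀ φ (P Q : List ℕ) → Σ Fm (λ θ → IsULI φ P Q θ)

{-# OPTIONS --safe #-}
module Submission where

open import Defs
open import Data.Bool using (Bool; true; false; _∧_; _∨_; not; if_then_else_)
open import Data.Bool.Properties using (_≟_; ∨-zeroʳ; ¬-not; T-≡)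
open import Data.Empty using (⊥; ⊥-elim)
open import Data.List using (List; []; _∷_; _++_; map; filter; foldr; length; deduplicateᵇ;
  cartesianProductWith)
open import Data.List.Membership.Propositional using (_∈_; _∉_)
open import Data.List.Membership.Propositional.Properties
  using (∈-++⁺ˡ; ∈-++⁺ʳ; ∈-++⁻; ∈-map⁺; ∈-map⁻; ∈-filter⁺; ∈-filter⁻;
         ∈-cartesianProductWith⁺; ∈-cartesianProductWith⁻)
open import Data.List.Membership.Setoid.Properties using (∈-deduplicate⁺)
open import Data.List.Properties using (length-filter)
open import Data.List.Relation.Unary.Any using (here; there)
open import Data.Nat using (ℕ; zero; suc; _≤_; _<_; _+_; _*_; _≡ᵇ_; z≤n; s≤s; _≤′_; ≤′-refl; ≤′-step)
import Data.Nat.Properties as ℕ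
open import Data.Nat.Properties using (≤-refl; ≤-trans; ≤-reflexive; ⊔-lub; m≤n⇒m≤1+n; z≤′n;
  m≤m+n; m≤n+m; <⇒≤; ≤-pred; +-comm; *-comm)
open import Data.List.Membership.DecPropositional ℕ._≟_ using (_∈?_; _∉?_)
open import Data.Product using (_×_; Σ; _,_; proj₁; proj₂)
open import Data.Sum using (_⊎_; inj₁; inj₂; [_,_]′)
open import Data.Unit using (⊤; tt)
open import Function using (_∘_; id; Equivalence)
open import Relation.Binary.PropositionalEquality using (_≡_; refl; sym; trans; cong; cong₂)
  renaming (subst to ≡-subst; setoid to ≡-setoid)
open import Relation.Nullary using (¬_; Dec; yes; no)
open import Relation.Nullary.Decidable using (_×-dec_; ¬?; does; dec-true; T?)

-- Grz is complete for finite trees: a backward search for □b adds the hypothesis □(b → □b), and in its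
-- presence b ∧ ¬□b is contradictory, so every boxed subformula is unfolded at most once on a branch.
--
-- Finitely many formulas of modal depth at most i over the signed variables v⁺(φ)∖P and v⁻(φ)∖Q
-- characterise the i-layered Lyndon simulation s ≼ᵢ t towards any tree t.  The interpolant is the
-- conjunction of those of their negations that φ implies, for i = 3n(φ) + 3.  If it holds at t, then φ
-- holds at some s with s ≼ᵢ t.
--
-- Such s and t are amalgamated into a tree x satisfying φ from which all formulas without positive P and
-- negative Q transfer to t.  Its nodes pair a subtree of s with one of t.  To refute b, jump to the
-- last point refuting b.  If that does not make a new boxed subformula of φ true, the next jump does:
-- above a last point refuting b, □b holds.  So each of the n(φ) possible increases costs two layers for
-- jumps and one for matching the successors of t, for which a pair with one extra layer is remembered.

-- Finite choice, covers and sublists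

all-or : ∀ {X : Set} {P : X → Set} {C : Set} (xs : List X) →
  (∀ {x} → x ∈ xs → P x ⊎ C) → (∀ {x} → x ∈ xs → P x) ⊎ C
all-or [] f = inj₁ λ ()
all-or (x ∷ xs) f with f (here refl) | all-or xs (f ∘ there)
... | inj₂ c | _ = inj₂ c
... | inj₁ _ | inj₂ c = inj₂ c
... | inj₁ p | inj₁ g = inj₁ λ { (here refl) → p ; (there i) → g i }

-- The Egli-Milner lifting of `R` to lists.
Covers : ∀ {X Y : Set} → (X → Y → Set) → List X → List Y → Set
Covers {X} {Y} R xs ys =
  (∀ {x} → x ∈ xs → Σ Y λ y → y ∈ ys × R x y) ×
  (∀ {y} → y ∈ ys → Σ X λ x → x ∈ xs × R x y)

collect : ∀ {X Y : Set} {R : X → Y → Set} (xs : List X) →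
  (∀ {x} → x ∈ xs → Σ Y (R x)) → Σ (List Y) (Covers R xs)
collect [] f = [] , (λ ()) , (λ ())
collect (x ∷ xs) f with f (here refl) | collect xs (f ∘ there)
... | y , r | ys , to , from = y ∷ ys
  , (λ { (here refl) → y , here refl , r
       ; (there i) → let (y' , j , r') = to i in y' , there j , r' })
  , (λ { (here refl) → x , here refl , r
       ; (there i) → let (x' , j , r') = from i in x' , there j , r' })

sublists : ∀ {X : Set} → List X → List (List X)
sublists [] = [] ∷ []
sublists (x ∷ xs) = map (x ∷_) (sublists xs) ++ sublists xs

[]∈sublists : ∀ {X : Set} (xs : List X) → [] ∈ sublists xs
[]∈sublists [] = here refl
[]∈sublists (x ∷ xs) = ∈-++⁺ʳ (map (x ∷_) (sublists xs)) ([]∈sublists xs)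

sublists-⊆ : ∀ {X : Set} (xs : List X) {ys y} → ys ∈ sublists xs → y ∈ ys → y ∈ xs
sublists-⊆ [] (here refl) ()
sublists-⊆ (x ∷ xs) i j with ∈-++⁻ (map (x ∷_) (sublists xs)) i
... | inj₂ i' = there (sublists-⊆ xs i' j)
... | inj₁ i' with ∈-map⁻ (x ∷_) i' | j
...   | _ , _ , refl | here refl = here refl
...   | _ , i'' , refl | there j' = there (sublists-⊆ xs i'' j')

-- `sublists xs` keeps the order of `xs`, so `x ∷ ys` itself is in general not listed; a sublist
-- with the same members replaces it.
sublists-insert : ∀ {X : Set} (xs : List X) {ys x} → ys ∈ sublists xs → x ∈ xs →
  Σ (List X) λ zs → zs ∈ sublists xs ×
    (∀ {z} → z ∈ (x ∷ ys) → z ∈ zs) × (∀ {z} → z ∈ zs → z ∈ (x ∷ ys))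
sublists-insert (x ∷ xs) i j with ∈-++⁻ (map (x ∷_) (sublists xs)) i
sublists-insert (x ∷ xs) {ys} i (here refl) | inj₂ i' =
  x ∷ ys , ∈-++⁺ˡ (∈-map⁺ (x ∷_) i') , id , id
sublists-insert (x ∷ xs) i (there j) | inj₂ i' with sublists-insert xs i' j
... | zs , l , f , g = zs , ∈-++⁺ʳ (map (x ∷_) (sublists xs)) l , f , g
sublists-insert (x ∷ xs) i j | inj₁ i' with ∈-map⁻ (x ∷_) i'
sublists-insert (x ∷ xs) i (here refl) | inj₁ i' | ys' , _ , refl =
  x ∷ ys' , i , (λ { (here refl) → here refl ; (there q) → q }) , there
sublists-insert (x ∷ xs) i (there j) | inj₁ i' | ys' , i'' , refl with sublists-insert xs i'' j
... | zs , l , f , g = x ∷ zs , ∈-++⁺ˡ (∈-map⁺ (x ∷_) l)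
  , (λ { (here refl) → there (f (here refl))
       ; (there (here refl)) → here refl
       ; (there (there q)) → there (f (there q)) })
  , (λ { (here refl) → there (here refl)
       ; (there q) → swap (g q) })
  where
  swap : ∀ {z} → z ∈ (_ ∷ ys') → z ∈ (_ ∷ x ∷ ys')
  swap (here refl) = here refl
  swap (there q) = there (there q)

-- A `collect` whose result ranges over finitely many lists fixed in advance, so that one finite
-- stock of formulas can describe all trees.
cover : ∀ {X Y : Set} {R : X → Y → Set} (ys : List Y) (xs : List X) →
  (∀ {x} → x ∈ xs → Σ Y λ y → y ∈ ys × R x y) →
  Σ (List Y) λ zs → zs ∈ sublists ys × Covers R xs zs
cover ys [] f = [] , []∈sublists ys , (λ ()) , (λ ())
cover ys (x ∷ xs) f with f (here refl) | cover ys xs (f ∘ there)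
... | y , i , r | zs , l , to , from with sublists-insert ys l i
...   | zs' , l' , in' , out = zs' , l'
  , (λ { (here refl) → y , in' (here refl) , r
       ; (there j) → let (y' , j' , r') = to j in y' , in' (there j') , r' })
  , (λ j → back (out j))
  where
  back : ∀ {z} → z ∈ (y ∷ zs) → Σ _ λ x' → x' ∈ (x ∷ xs) × _
  back (here refl) = x , here refl , r
  back (there j) = let (x' , j' , r') = from j in x' , there j' , r'

remove : ∀ {X : Set} {x : X} {xs} → x ∈ xs →
  Σ (List X) λ ys → suc (length ys) ≡ length xs × (∀ {y} → y ∈ xs → y ∈ ys ⊎ y ≡ x)
remove {xs = x ∷ xs} (here refl) = xs , refl , λ { (here e) → inj₂ e ; (there i) → inj₁ i }
remove {xs = x ∷ xs} (there i) with remove i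
... | ys , e , f = x ∷ ys , cong suc e
  , λ { (here refl) → inj₁ (here refl)
      ; (there j) → [ inj₁ ∘ there , inj₂ ]′ (f j) }

-- Boolean connectives and equality of formulas

imp⁺ : ∀ {a b} → (a ≡ true → b ≡ true) → not a ∨ b ≡ true
imp⁺ {false} f = refl
imp⁺ {true} f = f refl

imp⁻ : ∀ {a b} → not a ∨ b ≡ true → a ≡ true → b ≡ true
imp⁻ {true} e refl = e

∧⁺ : ∀ {a b} → a ≡ true → b ≡ true → a ∧ b ≡ true
∧⁺ refl e = e

∧⁻ : ∀ {a b} → a ∧ b ≡ true → a ≡ true × b ≡ true
∧⁻ {true} e = refl , e

∨⁺ˡ : ∀ {a b} → a ≡ true → a ∨ b ≡ true
∨⁺ˡ refl = refl

∨⁺ʳ : ∀ a {b} → b ≡ true → a ∨ b ≡ true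
∨⁺ʳ a refl = ∨-zeroʳ a

∨⁻ : ∀ {a b} → a ∨ b ≡ true → a ≡ true ⊎ b ≡ true
∨⁻ {true} e = inj₁ refl
∨⁻ {false} e = inj₂ e

does-true : ∀ {X : Set} (x? : Dec X) → does x? ≡ true → X
does-true (yes x) _ = x

==-sound : ∀ a b → (a == b) ≡ true → a ≡ b
==-sound (var x) (var y) e = cong var (≡ᵇ-sound x y e)
  where
  ≡ᵇ-sound : ∀ i j → (i ≡ᵇ j) ≡ true → i ≡ j
  ≡ᵇ-sound zero zero e = refl
  ≡ᵇ-sound (suc i) (suc j) e = cong suc (≡ᵇ-sound i j e)
==-sound ⊥' ⊥' e = refl
==-sound (a ⇒ b) (c ⇒ f) e =
  cong₂ _⇒_ (==-sound a c (proj₁ (∧⁻ e))) (==-sound b f (proj₂ (∧⁻ e)))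
==-sound (□ a) (□ b) e = cong □_ (==-sound a b e)

==-refl : ∀ a → (a == a) ≡ true
==-refl (var x) = ≡ᵇ-refl x
  where
  ≡ᵇ-refl : ∀ i → (i ≡ᵇ i) ≡ true
  ≡ᵇ-refl zero = refl
  ≡ᵇ-refl (suc i) = ≡ᵇ-refl i
==-refl ⊥' = refl
==-refl (a ⇒ b) = ∧⁺ (==-refl a) (==-refl b)
==-refl (□ a) = ==-refl a

-- Propositional reasoning under an arbitrary truth assignment

infixr 4 _∧'_
_∧'_ : Fm → Fm → Fm
a ∧' b = ¬' (a ⇒ ¬' b)

⋀ ⋁ : List Fm → Fm
⋀ [] = ¬' ⊥'
⋀ (a ∷ as) = a ∧' ⋀ as
⋁ [] = ⊥'
⋁ (a ∷ as) = ¬' a ⇒ ⋁ as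

infixr 4 _⟹_
_⟹_ : List Fm → Fm → Fm
hs ⟹ g = foldr _⇒_ g hs

module Connectives {W : Set} (f : W → Fm → Bool) (f⊥ : ∀ w → f w ⊥' ≡ false)
                   (f⇒ : ∀ w a b → f w (a ⇒ b) ≡ not (f w a) ∨ f w b) where

  infix 4 _⊨_
  -- A record rather than the bare equation: `f w a` would compute away once `f` is `eval` or
  -- `truth`, and `w` and `a` could no longer be inferred.
  record _⊨_ (w : W) (a : Fm) : Set where
    constructor ⟨_⟩
    field holds : f w a ≡ true
  open _⊨_ public

  _⊨?_ : ∀ w a → Dec (w ⊨ a)
  w ⊨? a with f w a ≟ true
  ... | yes e = yes ⟨ e ⟩
  ... | no ne = no (ne ∘ holds)

  by-contradiction : ∀ {w a} → (¬ w ⊨ a → ⊥) → w ⊨ a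
  by-contradiction {w} {a} g with w ⊨? a
  ... | yes x = x
  ... | no nx = ⊥-elim (g nx)

  ⊨⊥ : ∀ {w} → w ⊨ ⊥' → ⊥
  ⊨⊥ {w} e with trans (sym (f⊥ w)) (holds e)
  ... | ()

  ⇒⁺ : ∀ {w a b} → (w ⊨ a → w ⊨ b) → w ⊨ (a ⇒ b)
  ⇒⁺ g = ⟨ trans (f⇒ _ _ _) (imp⁺ λ e → holds (g ⟨ e ⟩)) ⟩

  ⇒⁻ : ∀ {w a b} → w ⊨ (a ⇒ b) → w ⊨ a → w ⊨ b
  ⇒⁻ e x = ⟨ imp⁻ (trans (sym (f⇒ _ _ _)) (holds e)) (holds x) ⟩

  ¬⁺ : ∀ {w a} → ¬ w ⊨ a → w ⊨ ¬' a
  ¬⁺ g = ⇒⁺ (⊥-elim ∘ g)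

  ¬⁻ : ∀ {w a} → w ⊨ ¬' a → ¬ w ⊨ a
  ¬⁻ e x = ⊨⊥ (⇒⁻ e x)

  ∧'⁺ : ∀ {w a b} → w ⊨ a → w ⊨ b → w ⊨ (a ∧' b)
  ∧'⁺ x y = ¬⁺ λ e → ¬⁻ (⇒⁻ e x) y

  ∧'⁻ : ∀ {w a b} → w ⊨ (a ∧' b) → w ⊨ a × w ⊨ b
  ∧'⁻ e = by-contradiction (λ na → ¬⁻ e (⇒⁺ (⊥-elim ∘ na)))
        , by-contradiction (λ nb → ¬⁻ e (⇒⁺ (λ _ → ¬⁺ nb)))

  ⋀⁺ : ∀ {w as} → (∀ {a} → a ∈ as → w ⊨ a) → w ⊨ ⋀ as
  ⋀⁺ {as = []} g = ⇒⁺ id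
  ⋀⁺ {as = a ∷ as} g = ∧'⁺ (g (here refl)) (⋀⁺ (g ∘ there))

  ⋀⁻ : ∀ {w as a} → w ⊨ ⋀ as → a ∈ as → w ⊨ a
  ⋀⁻ e (here refl) = proj₁ (∧'⁻ e)
  ⋀⁻ e (there i) = ⋀⁻ (proj₂ (∧'⁻ e)) i

  ⋁⁺ : ∀ {w as a} → a ∈ as → w ⊨ a → w ⊨ ⋁ as
  ⋁⁺ (here refl) x = ⇒⁺ λ e → ⊥-elim (¬⁻ e x)
  ⋁⁺ (there i) x = ⇒⁺ λ _ → ⋁⁺ i x

  ⋁⁻ : ∀ {w as} → w ⊨ ⋁ as → Σ Fm λ a → a ∈ as × w ⊨ a
  ⋁⁻ {as = []} e = ⊥-elim (⊨⊥ e)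
  ⋁⁻ {w} {a ∷ as} e with w ⊨? a
  ... | yes x = a , here refl , x
  ... | no nx = let (b , i , y) = ⋁⁻ (⇒⁻ e (¬⁺ nx)) in b , there i , y

  ⟹⁺ : ∀ {w} hs {g} → ((∀ {h} → h ∈ hs → w ⊨ h) → w ⊨ g) → w ⊨ (hs ⟹ g)
  ⟹⁺ [] c = c λ ()
  ⟹⁺ (h ∷ hs) c = ⇒⁺ λ x → ⟹⁺ hs λ y → c λ { (here refl) → x ; (there i) → y i }

  ⟹⁻ : ∀ {w} hs {g} → w ⊨ (hs ⟹ g) → (∀ {h} → h ∈ hs → w ⊨ h) → w ⊨ g
  ⟹⁻ [] e y = e
  ⟹⁻ (h ∷ hs) e y = ⟹⁻ hs (⇒⁻ e (y (here refl))) (y ∘ there)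

module E = Connectives eval (λ _ → refl) (λ _ _ _ → refl)

-- Hilbert-style derivations

module _ where
  open E

  tautology : ∀ {a} → (∀ V → V ⊨ a) → Grz⊢ a
  tautology f = taut (holds ∘ f)

  -- Premises are discharged one at a time by modus ponens, so propositional steps can be checked by
  -- valuations instead of Hilbert derivations.
  consequence : ∀ {g} hs → (∀ {h} → h ∈ hs → Grz⊢ h) →
    (∀ V → (∀ {h} → h ∈ hs → V ⊨ h) → V ⊨ g) → Grz⊢ g
  consequence [] ps f = tautology λ V → f V λ ()
  consequence (h ∷ hs) ps f =
    mp (consequence hs (ps ∘ there) λ V as → ⇒⁺ λ a →
          f V λ { (here refl) → a ; (there i) → as i })
       (ps (here refl))

  consequence₁ : ∀ {a g} → Grz⊢ a → (∀ V → V ⊨ a → V ⊨ g) → Grz⊢ g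
  consequence₁ p f = consequence (_ ∷ []) (λ { (here refl) → p }) λ V as → f V (as (here refl))

  consequence₂ : ∀ {a b g} → Grz⊢ a → Grz⊢ b → (∀ V → V ⊨ a → V ⊨ b → V ⊨ g) → Grz⊢ g
  consequence₂ p q f =
    consequence (_ ∷ _ ∷ []) (λ { (here refl) → p ; (there (here refl)) → q })
      λ V as → f V (as (here refl)) (as (there (here refl)))

  ⊢K : ∀ a b → Grz⊢ (□ (a ⇒ b) ⇒ □ a ⇒ □ b)
  ⊢K a b = us (λ { 0 → a ; _ → b }) k

  ⊢grz : ∀ a → Grz⊢ (□ (□ (a ⇒ □ a) ⇒ a) ⇒ a)
  ⊢grz a = us (λ _ → a) grz

  □-mono : ∀ {a b} → Grz⊢ (a ⇒ b) → Grz⊢ (□ a ⇒ □ b)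
  □-mono {a} {b} p = mp (⊢K a b) (nec p)

  □-⟹ : ∀ hs {g} → Grz⊢ (□ (hs ⟹ g) ⇒ (map □_ hs ⟹ □ g))
  □-⟹ [] = tautology λ V → ⇒⁺ id
  □-⟹ (h ∷ hs) = consequence₂ (⊢K h _) (□-⟹ hs)
    λ V e e' → ⇒⁺ λ x → ⇒⁺ λ y → ⇒⁻ e' (⇒⁻ (⇒⁻ e x) y)

  -- `a ⇒ (□ (a ⇒ □ a) ⇒ a)` is a tautology; boxing it makes `□ a` imply the premise of the Grz
  -- axiom.
  ⊢T : ∀ a → Grz⊢ (□ a ⇒ a)
  ⊢T a = consequence₂ (⊢grz a)
    (□-mono {a} {□ (a ⇒ □ a) ⇒ a} (tautology λ V → ⇒⁺ λ x → ⇒⁺ λ _ → x))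
    λ V e e' → ⇒⁺ λ x → ⇒⁻ e (⇒⁻ e' x)

  -- Grz applied to b = a ∧ (□a → □□a): given □a and □(b → □b), a successor violating □a would
  -- satisfy b, hence □b, hence □a.
  ⊢4 : ∀ a → Grz⊢ (□ a ⇒ □ □ a)
  ⊢4 a = consequence₂ (⊢grz b) (□-mono step)
    λ V e e' → ⇒⁺ λ x → ⇒⁻ (proj₂ (∧'⁻ (⇒⁻ e (⇒⁻ e' x)))) x
    where
    b = a ∧' (□ a ⇒ □ □ a)

    □b⇒□a : Grz⊢ (□ b ⇒ □ a)
    □b⇒□a = □-mono (tautology λ V → ⇒⁺ λ x → proj₁ (∧'⁻ x))

    successor : Grz⊢ ((b ⇒ □ b) ⇒ (a ⇒ □ a))
    successor = consequence₁ □b⇒□a λ V e → ⇒⁺ λ f → ⇒⁺ λ x → by-contradiction λ n□a →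
      n□a (⇒⁻ e (⇒⁻ f (∧'⁺ x (⇒⁺ (⊥-elim ∘ n□a)))))

    step : Grz⊢ (a ⇒ (□ (b ⇒ □ b) ⇒ b))
    step = consequence₂ (□-mono successor) (⊢K a (□ a)) λ V e e' →
      ⇒⁺ λ x → ⇒⁺ λ y → ∧'⁺ x (⇒⁺ λ z → ⇒⁻ (⇒⁻ e' (⇒⁻ e y)) z)

  keeps : Fm → Fm
  keeps a = a ⇒ □ a

  ⊢grz□ : ∀ a → Grz⊢ (□ (□ keeps a ⇒ a) ⇒ □ a)
  ⊢grz□ a = consequence₂ (⊢4 (□ keeps a ⇒ a)) (□-mono (⊢grz a))
    λ V e e' → ⇒⁺ λ x → ⇒⁻ e' (⇒⁻ e x)

  -- The backward step of the search. By 4 the hypotheses may be boxed twice, so the whole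
  -- derivation can be boxed, and `⊢grz□` discharges `□ keeps a`.
  grz-rule : ∀ hs {a} → Grz⊢ (map □_ (keeps a ∷ hs) ⟹ a) → Grz⊢ (map □_ hs ⟹ □ a)
  grz-rule hs {a} p = consequence (_ ∷ map four hs) premises λ V as →
    ⟹⁺ (map □_ hs) λ bs → ⟹⁻ (map □_ (map □_ hs)) (as (here refl)) (boxes V (as ∘ there) bs)
    where
    four : Fm → Fm
    four h = □ h ⇒ □ □ h

    reordered : Grz⊢ (map □_ hs ⟹ (□ keeps a ⇒ a))
    reordered = consequence₁ p λ V e →
      ⟹⁺ (map □_ hs) λ bs → ⇒⁺ λ x → ⟹⁻ (map □_ hs) (⇒⁻ e x) bs

    boxed : Grz⊢ (map □_ (map □_ hs) ⟹ □ a)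
    boxed = consequence₂ (mp (□-⟹ (map □_ hs)) (nec reordered)) (⊢grz□ a) λ V e e' →
      ⟹⁺ (map □_ (map □_ hs)) λ bs → ⇒⁻ e' (⟹⁻ (map □_ (map □_ hs)) e bs)

    premises : ∀ {h} → h ∈ ((map □_ (map □_ hs) ⟹ □ a) ∷ map four hs) → Grz⊢ h
    premises (here refl) = boxed
    premises (there i) with ∈-map⁻ four i
    ... | h , _ , refl = ⊢4 h

    boxes : ∀ V → (∀ {h} → h ∈ map four hs → V ⊨ h) →
      (∀ {h} → h ∈ map □_ hs → V ⊨ h) → ∀ {h} → h ∈ map □_ (map □_ hs) → V ⊨ h
    boxes V as bs i with ∈-map⁻ □_ i
    ... | _ , j , refl with ∈-map⁻ □_ j
    ...   | h , l , refl = ⇒⁻ (as (∈-map⁺ four l)) (bs j)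

-- Finite tree models

data Tree : Set where
  node : (ℕ → Bool) → List Tree → Tree

val : Tree → ℕ → Bool
val (node v _) = v

children : Tree → List Tree
children (node _ ts) = ts

-- The accessibility relation is the reflexive subtree relation.
mutual
  truth : Tree → Fm → Bool
  truth t (var p) = val t p
  truth t ⊥' = false
  truth t (a ⇒ b) = not (truth t a) ∨ truth t b
  truth (node v ts) (□ a) = truth (node v ts) a ∧ truths ts (□ a)

  truths : List Tree → Fm → Bool
  truths [] a = true
  truths (t ∷ ts) a = truth t a ∧ truths ts a

infix 4 _⊑_
open Connectives truth (λ _ → refl) (λ _ _ _ → refl)
  renaming (_⊨_ to _⊩_; _⊨?_ to _⊩?_)

truths⁺ : ∀ ts {a} → (∀ {c} → c ∈ ts → c ⊩ a) → truths ts a ≡ true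
truths⁺ [] f = refl
truths⁺ (t ∷ ts) f = ∧⁺ (holds (f (here refl))) (truths⁺ ts (f ∘ there))

truths⁻ : ∀ {ts a c} → truths ts a ≡ true → c ∈ ts → c ⊩ a
truths⁻ e (here refl) = ⟨ proj₁ (∧⁻ e) ⟩
truths⁻ {t ∷ ts} {a} e (there i) = truths⁻ (proj₂ (∧⁻ {truth t a} e)) i

□-root : ∀ {t a} → t ⊩ □ a → t ⊩ a
□-root {node _ _} ⟨ e ⟩ = ⟨ proj₁ (∧⁻ e) ⟩

□-child : ∀ {t a c} → t ⊩ □ a → c ∈ children t → c ⊩ □ a
□-child {node v ts} {a} ⟨ e ⟩ i = truths⁻ (proj₂ (∧⁻ {truth (node v ts) a} e)) i

□-intro : ∀ {t a} → t ⊩ a → (∀ {c} → c ∈ children t → c ⊩ □ a) → t ⊩ □ a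
□-intro {node _ ts} ⟨ x ⟩ f = ⟨ ∧⁺ x (truths⁺ ts f) ⟩

data _⊑_ (s : Tree) : Tree → Set where
  root  : s ⊑ s
  below : ∀ {c t} → c ∈ children t → s ⊑ c → s ⊑ t

⊑-trans : ∀ {r s t} → r ⊑ s → s ⊑ t → r ⊑ t
⊑-trans p root = p
⊑-trans p (below i q) = below i (⊑-trans p q)

□-⊑ : ∀ {s t a} → t ⊩ □ a → s ⊑ t → s ⊩ □ a
□-⊑ e root = e
□-⊑ e (below i p) = □-⊑ (□-child e i) p

□⁻ : ∀ {s t a} → t ⊩ □ a → s ⊑ t → s ⊩ a
□⁻ e p = □-root (□-⊑ e p)

LastRefuting : Fm → Tree → Set
LastRefuting a s = ¬ s ⊩ a × (∀ {c} → c ∈ children s → c ⊩ □ a)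

mutual
  -- Children are searched before the root, so the root is returned only once `□ a` is known at
  -- every child.
  □-or-last : ∀ t a → t ⊩ □ a ⊎ Σ Tree λ s → s ⊑ t × LastRefuting a s
  □-or-last (node v ts) a with □-or-last-child ts a
  ... | inj₂ (c , i , s , p , l) = inj₂ (s , below i p , l)
  ... | inj₁ f with node v ts ⊩? a
  ...   | yes x = inj₁ (□-intro x f)
  ...   | no nx = inj₂ (node v ts , root , nx , f)

  □-or-last-child : ∀ ts a → (∀ {c} → c ∈ ts → c ⊩ □ a) ⊎
    Σ Tree λ c → c ∈ ts × Σ Tree λ s → s ⊑ c × LastRefuting a s
  □-or-last-child [] a = inj₁ λ ()
  □-or-last-child (t ∷ ts) a with □-or-last t a | □-or-last-child ts a
  ... | inj₂ l | _ = inj₂ (t , here refl , l)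
  ... | inj₁ _ | inj₂ (c , i , l) = inj₂ (c , there i , l)
  ... | inj₁ x | inj₁ f = inj₁ λ { (here refl) → x ; (there i) → f i }

last-refuting : ∀ {t a} → ¬ t ⊩ □ a → Σ Tree λ s → s ⊑ t × LastRefuting a s
last-refuting {t} {a} n□ with □-or-last t a
... | inj₁ e = ⊥-elim (n□ e)
... | inj₂ l = l

□⁺ : ∀ {t a} → (∀ {s} → s ⊑ t → s ⊩ a) → t ⊩ □ a
□⁺ f = by-contradiction λ n□ → let (_ , p , nx , _) = last-refuting n□ in nx (f p)

◇⁺ : ∀ {s t a} → s ⊑ t → s ⊩ a → t ⊩ ◇ a
◇⁺ p x = ¬⁺ λ e → ¬⁻ (□⁻ e p) x

◇⁻ : ∀ {t a} → t ⊩ ◇ a → Σ Tree λ s → s ⊑ t × s ⊩ a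
◇⁻ e = let (s , p , nna , _) = last-refuting (¬⁻ e) in
  s , p , by-contradiction (nna ∘ ¬⁺)

-- Soundness for finite trees

subst-subst : ∀ σ τ a → subst σ (subst τ a) ≡ subst (subst σ ∘ τ) a
subst-subst σ τ (var p) = refl
subst-subst σ τ ⊥' = refl
subst-subst σ τ (a ⇒ b) = cong₂ _⇒_ (subst-subst σ τ a) (subst-subst σ τ b)
subst-subst σ τ (□ a) = cong □_ (subst-subst σ τ a)

subst-var : ∀ a → subst var a ≡ a
subst-var (var p) = refl
subst-var ⊥' = refl
subst-var (a ⇒ b) = cong₂ _⇒_ (subst-var a) (subst-var b)
subst-var (□ a) = cong □_ (subst-var a)

truth-subst : ∀ t σ a → truth t (subst σ a) ≡ eval (truth t ∘ subst σ) a
truth-subst t σ (var p) = refl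
truth-subst t σ ⊥' = refl
truth-subst t σ (a ⇒ b) = cong₂ (λ x y → not x ∨ y) (truth-subst t σ a) (truth-subst t σ b)
truth-subst t σ (□ a) = refl

-- At a last point refuting `a`, the formula `a ⇒ □ a` holds vacuously, and above it because `□ a`
-- holds there; the hypothesis then forces `a` at that point.
⊩grz : ∀ t a → t ⊩ □ (□ (a ⇒ □ a) ⇒ a) ⇒ a
⊩grz t a = ⇒⁺ λ e → by-contradiction λ nx →
  let (s , p , ns , f) = last-refuting {t} {a} (nx ∘ □-root) in
  ns (⇒⁻ (□⁻ e p) (□-intro (⇒⁺ (⊥-elim ∘ ns)) λ i → □⁺ λ q → ⇒⁺ λ _ → □-⊑ (f i) q))

-- Quantifying over `σ` turns the case `us` into a composition of substitutions and keeps the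
-- induction structural.
sound-subst : ∀ {a} → Grz⊢ a → ∀ σ t → t ⊩ subst σ a
sound-subst (taut {a} f) σ t = ⟨ trans (truth-subst t σ a) (f _) ⟩
sound-subst k σ t = ⇒⁺ λ e → ⇒⁺ λ x → □⁺ λ p → ⇒⁻ (□⁻ e p) (□⁻ x p)
sound-subst grz σ t = ⊩grz t (σ 0)
sound-subst (mp x y) σ t = ⇒⁻ (sound-subst x σ t) (sound-subst y σ t)
sound-subst (nec x) σ t = □⁺ λ {s} _ → sound-subst x σ s
sound-subst (us {a} τ x) σ t rewrite subst-subst σ τ a = sound-subst x (subst σ ∘ τ) t

sound : ∀ {a} → Grz⊢ a → ∀ t → t ⊩ a
sound {a} x t with sound-subst x var t
... | y rewrite subst-var a = y

-- Completeness for finite trees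

-- The recursion continues below boxes, so one list of atoms also decides the bodies of all boxed
-- subformulas.
atoms : Fm → List Fm
atoms (var p) = var p ∷ []
atoms ⊥' = []
atoms (a ⇒ b) = atoms a ++ atoms b
atoms (□ a) = □ a ∷ atoms a

boxedSubs-atoms : ∀ a {b x} → b ∈ boxedSubs a → x ∈ atoms (□ b) → x ∈ atoms a
boxedSubs-atoms (a ⇒ b) i j with ∈-++⁻ (boxedSubs a) i
... | inj₁ i' = ∈-++⁺ˡ (boxedSubs-atoms a i' j)
... | inj₂ i' = ∈-++⁺ʳ (atoms a) (boxedSubs-atoms b i' j)
boxedSubs-atoms (□ a) (here refl) j = j
boxedSubs-atoms (□ a) (there i) j = there (boxedSubs-atoms a i j)

atoms-boxedSubs : ∀ a {b} → □ b ∈ atoms a → b ∈ boxedSubs a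
atoms-boxedSubs (var p) (here ())
atoms-boxedSubs (a ⇒ b) i with ∈-++⁻ (atoms a) i
... | inj₁ j = ∈-++⁺ˡ (atoms-boxedSubs a j)
... | inj₂ j = ∈-++⁺ʳ (boxedSubs a) (atoms-boxedSubs b j)
atoms-boxedSubs (□ a) (here refl) = here refl
atoms-boxedSubs (□ a) (there i) = there (atoms-boxedSubs a i)

literal : (Fm → Bool) → Fm → Fm
literal V a = if V a then a else ¬' a

literals : (Fm → Bool) → List Fm → List Fm
literals V = map (literal V)

literal⁺ : ∀ W V a → eval W a ≡ V a → W E.⊨ literal V a
literal⁺ W V a e with V a
... | true = E.⟨ e ⟩
... | false = E.¬⁺ λ { E.⟨ e' ⟩ → true≢false (trans (sym e') e) }
  where
  true≢false : ¬ true ≡ false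
  true≢false ()

literal⁻ : ∀ W V a → W E.⊨ literal V a → eval W a ≡ V a
literal⁻ W V a x with V a
... | true = E.holds x
... | false = ¬-not (E.¬⁻ x ∘ E.⟨_⟩)

update : Fm → Bool → (Fm → Bool) → Fm → Bool
update a b V x = if a == x then b else V x

valuations : List Fm → List (Fm → Bool)
valuations [] = (λ _ → false) ∷ []
valuations (a ∷ as) = map (update a true) (valuations as) ++ map (update a false) (valuations as)

update-∈ : ∀ a b as {V} → V ∈ valuations as → update a b V ∈ valuations (a ∷ as)
update-∈ a true as i = ∈-++⁺ˡ (∈-map⁺ (update a true) i)
update-∈ a false as i = ∈-++⁺ʳ (map (update a true) (valuations as)) (∈-map⁺ (update a false) i)

valuations-complete : ∀ (W : Fm → Bool) as →
  Σ (Fm → Bool) λ V → V ∈ valuations as × (∀ {a} → a ∈ as → W a ≡ V a)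
valuations-complete W [] = (λ _ → false) , here refl , λ ()
valuations-complete W (a ∷ as) with valuations-complete W as
... | V , i , e = update a (W a) V , update-∈ a (W a) as i , agree
  where
  agree : ∀ {x} → x ∈ (a ∷ as) → W x ≡ update a (W a) V x
  agree (here refl) rewrite ==-refl a = refl
  agree {x} (there j) with a == x in eq
  ... | true = cong W (sym (==-sound a x eq))
  ... | false = e j

module Search (χ : Fm) where

  At B : List Fm
  At = atoms χ
  B = boxedSubs χ

  Closed : Fm → Set
  Closed a = ∀ {x} → x ∈ atoms a → x ∈ At

  by-cases : ∀ {g} → (∀ {V} → V ∈ valuations At → Grz⊢ (literals V At ⟹ g)) → Grz⊢ g
  by-cases {g} f = consequence (map case (valuations At)) premises λ W as →
    let (V , i , e) = valuations-complete (eval W) At in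
    E.⟹⁻ (literals V At) (as (∈-map⁺ case i)) (true-literals W V e)
    where
    case : (Fm → Bool) → Fm
    case V = literals V At ⟹ g

    premises : ∀ {h} → h ∈ map case (valuations At) → Grz⊢ h
    premises i with ∈-map⁻ case i
    ... | V , j , refl = f j

    true-literals : ∀ W V → (∀ {a} → a ∈ At → eval W a ≡ V a) →
      ∀ {h} → h ∈ literals V At → W E.⊨ h
    true-literals W V e i with ∈-map⁻ (literal V) i
    ... | a , j , refl = literal⁺ W V a (e j)

  agreement : ∀ W V → (∀ {h} → h ∈ literals V At → W E.⊨ h) →
    ∀ a → Closed a → eval W a ≡ eval V a
  agreement W V ls (var p) cl = literal⁻ W V (var p) (ls (∈-map⁺ (literal V) (cl (here refl))))
  agreement W V ls ⊥' cl = refl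
  agreement W V ls (a ⇒ b) cl = cong₂ (λ x y → not x ∨ y)
    (agreement W V ls a (cl ∘ ∈-++⁺ˡ)) (agreement W V ls b (cl ∘ ∈-++⁺ʳ (atoms a)))
  agreement W V ls (□ a) cl = literal⁻ W V (□ a) (ls (∈-map⁺ (literal V) (cl (here refl))))

  Provable : List Fm → List Fm → Fm → Set
  Provable D Γ g = Grz⊢ (map □_ (map keeps D ++ Γ) ⟹ g)

  -- The tree answers for `Γ` only; the assumptions `keeps b` for `b` in `D` belong to the
  -- derivation side. For empty `D` the two outcomes exclude each other.
  Refuted : List Fm → Fm → Set
  Refuted Γ g = Σ Tree λ t → (∀ {c} → c ∈ Γ → t ⊩ □ c) × ¬ t ⊩ g

  -- A valuation `V` is tried as the root of a refuting tree, with `jump` supplying the children; if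
  -- it does not fit, the case `V` of the derivation is closed.
  module Leaf (D Γ : List Fm) (Γ⊆B : ∀ {c} → c ∈ Γ → c ∈ B) (g : Fm) (closed : Closed g)
    (jump : ∀ Γ' → (∀ {c} → c ∈ Γ' → c ∈ B) → ∀ {b} → b ∈ B →
      b ∈ D ⊎ (Provable (b ∷ D) Γ' b ⊎ Refuted Γ' b))
    (V : Fm → Bool) where

    Excluded : Set
    Excluded = Grz⊢ (literals V At ⟹ map □_ (map keeps D ++ Γ) ⟹ g)

    exclude : ∀ {a} → Grz⊢ a →
      (∀ W → W E.⊨ a → (∀ b → Closed b → eval W b ≡ eval V b) →
        (∀ {b} → b ∈ (map keeps D ++ Γ) → W E.⊨ □ b) → W E.⊨ g) → Excluded
    exclude p f = consequence₁ p λ W x → E.⟹⁺ (literals V At) λ ls →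
      E.⟹⁺ (map □_ (map keeps D ++ Γ)) λ bs →
        f W x (agreement W V ls) λ i → bs (∈-map⁺ □_ i)

    to : ∀ {W a} → eval W a ≡ eval V a → W E.⊨ a → V E.⊨ a
    to e E.⟨ x ⟩ = E.⟨ trans (sym e) x ⟩

    from : ∀ {W a} → eval W a ≡ eval V a → V E.⊨ a → W E.⊨ a
    from e E.⟨ x ⟩ = E.⟨ trans e x ⟩

    closed-□ : ∀ {b} → b ∈ B → Closed (□ b)
    closed-□ i j = boxedSubs-atoms χ i j

    closed-body : ∀ {b} → b ∈ B → Closed b
    closed-body i = closed-□ i ∘ there

    -- If `b` is false at the root, the root itself refutes `□ b` by reflexivity; a child is
    -- required only when `b` is true and `□ b` false.
    needy? : ∀ b → Dec (¬ V E.⊨ □ b × V E.⊨ b)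
    needy? b = ¬? (V E.⊨? (□ b)) ×-dec V E.⊨? b

    Γ' needy : List Fm
    Γ' = filter (λ b → V E.⊨? (□ b)) B
    needy = filter needy? B

    Γ'⊆B : ∀ {c} → c ∈ Γ' → c ∈ B
    Γ'⊆B i = proj₁ (∈-filter⁻ (λ b → V E.⊨? (□ b)) {xs = B} i)

    □-holds : ∀ {c} → c ∈ Γ' → V E.⊨ □ c
    □-holds i = proj₂ (∈-filter⁻ (λ b → V E.⊨? (□ b)) {xs = B} i)

    context-holds : ∀ {c} → c ∈ Γ → V E.⊨ □ c ⊎ Excluded
    context-holds {c} i with V E.⊨? (□ c)
    ... | yes x = inj₁ x
    ... | no nx = inj₂ (exclude (⊢T c) λ W _ e bs →
      ⊥-elim (nx (to (e (□ c) (closed-□ (Γ⊆B i))) (bs (∈-++⁺ʳ (map keeps D) i)))))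

    reflexive : ∀ {b} → b ∈ B → (V E.⊨ □ b → V E.⊨ b) ⊎ Excluded
    reflexive {b} i with V E.⊨? (□ b) | V E.⊨? b
    ... | no nx | _ = inj₁ (⊥-elim ∘ nx)
    ... | yes x | yes y = inj₁ λ _ → y
    ... | yes x | no ny = inj₂ (exclude (⊢T b) λ W t e bs →
      ⊥-elim (ny (to (e b (closed-body i)) (E.⇒⁻ t (from (e (□ b) (closed-□ i)) x)))))

    successor : ∀ {b} → b ∈ needy → Refuted Γ' b ⊎ Excluded
    successor {b} i with ∈-filter⁻ needy? {xs = B} i
    ... | j , nx , y with jump Γ' Γ'⊆B j
    ...   | inj₂ (inj₂ r) = inj₁ r
    -- `□ keeps b` is already assumed, so the truth of `b` forces `□ b`, which `V` denies.
    ...   | inj₁ l = inj₂ (exclude (⊢T (keeps b)) λ W t e bs →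
      ⊥-elim (nx (to (e (□ b) (closed-□ j)) (E.⇒⁻ (E.⇒⁻ t (bs (∈-++⁺ˡ (∈-map⁺ keeps l))))
                                              (from (e b (closed-body j)) y)))))
    -- Here `grz-rule` derives `□ b` from the assumptions for `D` and the boxes true under `V`,
    -- again against `V`.
    ...   | inj₂ (inj₁ p) = inj₂ (exclude (grz-rule (map keeps D ++ Γ') p) λ W t e bs →
      ⊥-elim (nx (to (e (□ b) (closed-□ j)) (E.⟹⁻ (map □_ (map keeps D ++ Γ')) t (hyps W e bs)))))
      where
      hyps : ∀ W → (∀ b → Closed b → eval W b ≡ eval V b) →
        (∀ {b} → b ∈ (map keeps D ++ Γ) → W E.⊨ □ b) →
        ∀ {h} → h ∈ map □_ (map keeps D ++ Γ') → W E.⊨ h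
      hyps W e bs q with ∈-map⁻ □_ q
      ... | c , q' , refl with ∈-++⁻ (map keeps D) q'
      ...   | inj₁ q'' = bs (∈-++⁺ˡ q'')
      ...   | inj₂ q'' = from (e (□ c) (closed-□ (Γ'⊆B q''))) (□-holds q'')

    leaf : Excluded ⊎ Refuted Γ g
    leaf with V E.⊨? g | all-or Γ context-holds | all-or B reflexive | all-or needy successor
    -- `V` itself satisfies `g`, so any theorem can be handed to `exclude`.
    ... | yes x | _ | _ | _ = inj₁ (exclude (⊢T ⊥') λ W _ e _ → from (e g closed) x)
    ... | no _ | inj₂ ex | _ | _ = inj₁ ex
    ... | no _ | inj₁ _ | inj₂ ex | _ = inj₁ ex
    ... | no _ | inj₁ _ | inj₁ _ | inj₂ ex = inj₁ ex
    ... | no nx | inj₁ ctx | inj₁ rfl | inj₁ suc' =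
      inj₂ (t , (λ i → ⟨ trans (truth-lemma (□ _) (closed-□ (Γ⊆B i))) (E.holds (ctx i)) ⟩)
           , λ { ⟨ y ⟩ → nx E.⟨ trans (sym (truth-lemma g closed)) y ⟩ })
      where
      col = collect {R = λ b t → (∀ {c} → c ∈ Γ' → t ⊩ □ c) × ¬ t ⊩ b} needy suc'
      t = node (λ p → V (var p)) (proj₁ col)

      -- Every child was built with context `Γ'` and so satisfies all boxes true under `V`; a false
      -- box is refuted at the root or at the child built for it.
      truth-lemma : ∀ a → Closed a → truth t a ≡ eval V a
      truth-lemma (var p) cl = refl
      truth-lemma ⊥' cl = refl
      truth-lemma (a ⇒ b) cl = cong₂ (λ x y → not x ∨ y)
        (truth-lemma a (cl ∘ ∈-++⁺ˡ)) (truth-lemma b (cl ∘ ∈-++⁺ʳ (atoms a)))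
      truth-lemma (□ a) cl with V E.⊨? (□ a) | V E.⊨? a | atoms-boxedSubs χ (cl (here refl))
      ... | yes x | _ | i = trans (holds (□-intro ⟨ trans (truth-lemma a (cl ∘ there)) (E.holds (rfl i x)) ⟩
          λ j → let (_ , _ , boxes , _) = proj₂ (proj₂ col) j in
                boxes (∈-filter⁺ (λ b → V E.⊨? (□ b)) i x)))
        (sym (E.holds x))
      ... | no nx | no ny | i = trans (¬-not λ y → ny E.⟨ trans (sym (truth-lemma a (cl ∘ there)))
            (holds (□-root {t} ⟨ y ⟩)) ⟩)
          (sym (¬-not (nx ∘ E.⟨_⟩)))
      ... | no nx | yes y | i = trans (¬-not λ z →
            let (c , j , _ , nc) = proj₁ (proj₂ col) (∈-filter⁺ needy? i (nx , y)) in
            nc (□-root (□-child {t} ⟨ z ⟩ j)))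
          (sym (¬-not (nx ∘ E.⟨_⟩)))

  -- R lists the boxed bodies b for which □ keeps b has not been assumed yet; every jump removes one.
  search : ∀ f {R} D → length R ≤ f → (∀ {b} → b ∈ B → b ∈ R ⊎ b ∈ D) →
    ∀ Γ → (∀ {c} → c ∈ Γ → c ∈ B) → ∀ g → Closed g → Provable D Γ g ⊎ Refuted Γ g
  search f {R} D bound split Γ Γ⊆B g closed
    with all-or (valuations At) (λ {V} _ → Leaf.leaf D Γ Γ⊆B g closed (jump f bound) V)
    where
    jump : ∀ f → length R ≤ f → ∀ Γ' → (∀ {c} → c ∈ Γ' → c ∈ B) → ∀ {b} → b ∈ B →
      b ∈ D ⊎ (Provable (b ∷ D) Γ' b ⊎ Refuted Γ' b)
    jump f bound Γ' Γ'⊆B {b} i with split i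
    ... | inj₂ j = inj₁ j
    ... | inj₁ j with remove j
    ...   | R' , len , out = inj₂ (go f (≤-trans (≤-reflexive len) bound))
      where
      split' : ∀ {c} → c ∈ B → c ∈ R' ⊎ c ∈ (b ∷ D)
      split' q with split q
      ... | inj₂ q' = inj₂ (there q')
      ... | inj₁ q' with out q'
      ...   | inj₁ q'' = inj₁ q''
      ...   | inj₂ refl = inj₂ (here refl)
      go : ∀ f → suc (length R') ≤ f → Provable (b ∷ D) Γ' b ⊎ Refuted Γ' b
      go (suc f') (s≤s bound') =
        search f' (b ∷ D) bound' split' Γ' Γ'⊆B b (boxedSubs-atoms χ i ∘ there)
  ... | inj₁ f = inj₁ (by-cases f)
  ... | inj₂ r = inj₂ r

complete : ∀ a → Grz⊢ a ⊎ Σ Tree λ t → ¬ t ⊩ a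
complete a with Search.search a _ [] ≤-refl inj₁ [] (λ ()) a id
... | inj₁ p = inj₁ p
... | inj₂ (t , _ , nx) = inj₂ (t , nx)

-- Layered Lyndon simulations and their characteristic formulas

-- Predicates in place of lists admit complements such as `_∉ P`; swapping them in antecedents
-- treats both signs in one recursion.
Polarised : (A B : ℕ → Set) → Fm → Set
Polarised A B (var p) = A p
Polarised A B ⊥' = ⊤
Polarised A B (a ⇒ b) = Polarised B A a × Polarised A B b
Polarised A B (□ a) = Polarised A B a

polarised⁺ : ∀ {A B} a → (∀ {p} → p ∈ v⁺ a → A p) → (∀ {p} → p ∈ v⁻ a → B p) → Polarised A B a
polarised⁺ (var p) f g = f (here refl)
polarised⁺ ⊥' f g = tt
polarised⁺ (a ⇒ b) f g = polarised⁺ a (g ∘ ∈-++⁺ˡ) (f ∘ ∈-++⁺ˡ)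
                       , polarised⁺ b (f ∘ ∈-++⁺ʳ (v⁻ a)) (g ∘ ∈-++⁺ʳ (v⁺ a))
polarised⁺ (□ a) f g = polarised⁺ a f g

polarised⁻ : ∀ {A B} a → Polarised A B a →
  (∀ {p} → p ∈ v⁺ a → A p) × (∀ {p} → p ∈ v⁻ a → B p)
polarised⁻ (var p) x = (λ { (here refl) → x }) , λ ()
polarised⁻ ⊥' x = (λ ()) , λ ()
polarised⁻ (a ⇒ b) (x , y) =
    ([ proj₂ (polarised⁻ a x) , proj₁ (polarised⁻ b y) ]′ ∘ ∈-++⁻ (v⁻ a))
  , ([ proj₁ (polarised⁻ a x) , proj₂ (polarised⁻ b y) ]′ ∘ ∈-++⁻ (v⁺ a))
polarised⁻ (□ a) x = polarised⁻ a x

polarised-⋀ : ∀ {A B} as → (∀ {a} → a ∈ as → Polarised A B a) → Polarised A B (⋀ as)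
polarised-⋀ [] f = tt , tt
polarised-⋀ (a ∷ as) f = (f (here refl) , polarised-⋀ as (f ∘ there) , tt) , tt

polarised-⋁ : ∀ {A B} as → (∀ {a} → a ∈ as → Polarised A B a) → Polarised A B (⋁ as)
polarised-⋁ [] f = tt
polarised-⋁ (a ∷ as) f = (f (here refl) , tt) , polarised-⋁ as (f ∘ there)

d-⋀ : ∀ {i} as → (∀ {a} → a ∈ as → d a ≤ i) → d (⋀ as) ≤ i
d-⋀ [] f = z≤n
d-⋀ (a ∷ as) f = ⊔-lub (⊔-lub (f (here refl)) (⊔-lub (d-⋀ as (f ∘ there)) z≤n)) z≤n

d-⋁ : ∀ {i} as → (∀ {a} → a ∈ as → d a ≤ i) → d (⋁ as) ≤ i
d-⋁ [] f = z≤n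
d-⋁ (a ∷ as) f = ⊔-lub (⊔-lub (f (here refl)) z≤n) (d-⋁ as (f ∘ there))

mutual
  subtrees : Tree → List Tree
  subtrees (node v ts) = node v ts ∷ subforest ts

  subforest : List Tree → List Tree
  subforest [] = []
  subforest (t ∷ ts) = subtrees t ++ subforest ts

subforest⁺ : ∀ {s t ts} → t ∈ ts → s ∈ subtrees t → s ∈ subforest ts
subforest⁺ (here refl) j = ∈-++⁺ˡ j
subforest⁺ {ts = t ∷ ts} (there i) j = ∈-++⁺ʳ (subtrees t) (subforest⁺ i j)

subtrees⁺ : ∀ {s t} → s ⊑ t → s ∈ subtrees t
subtrees⁺ {node _ _} root = here refl
subtrees⁺ {t = node _ _} (below i p) = there (subforest⁺ i (subtrees⁺ p))

mutual
  subtrees⁻ : ∀ {s} t → s ∈ subtrees t → s ⊑ t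
  subtrees⁻ (node v ts) (here refl) = root
  subtrees⁻ (node v ts) (there i) = let (_ , j , p) = subforest⁻ ts i in below j p

  subforest⁻ : ∀ {s} ts → s ∈ subforest ts → Σ Tree λ t → t ∈ ts × s ⊑ t
  subforest⁻ (t ∷ ts) i with ∈-++⁻ (subtrees t) i
  ... | inj₁ j = t , here refl , subtrees⁻ t j
  ... | inj₂ j = let (c , l , p) = subforest⁻ ts j in c , there l , p

module Layers (pos neg : List ℕ) where

  infix 4 _≼[_]_
  -- Each layer contains the previous one, so that giving up a layer is a projection.
  _≼[_]_ : Tree → ℕ → Tree → Set
  s ≼[ zero ] t = (∀ {p} → p ∈ pos → s ⊩ var p → t ⊩ var p) ×
                  (∀ {p} → p ∈ neg → t ⊩ var p → s ⊩ var p)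
  s ≼[ suc i ] t = s ≼[ i ] t ×
    (∀ {s'} → s' ⊑ s → Σ Tree λ t' → t' ⊑ t × s' ≼[ i ] t') ×
    (∀ {t'} → t' ⊑ t → Σ Tree λ s' → s' ⊑ s × s' ≼[ i ] t')

  ≼-anti : ∀ {i j s t} → i ≤′ j → s ≼[ j ] t → s ≼[ i ] t
  ≼-anti ≤′-refl x = x
  ≼-anti (≤′-step le) x = ≼-anti le (proj₁ x)

  ≼-atoms : ∀ i {s t} → s ≼[ i ] t → s ≼[ 0 ] t
  ≼-atoms i = ≼-anti (z≤′n {i})

  -- The signs are opposite to those of the interpolant, whose conjuncts are negated types.
  signed-atoms : List Fm
  signed-atoms = map (¬' ∘ var) pos ++ map var neg

  -- The cover modality of `es`, conjoined with a type `e` for the root.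
  layer : Fm → List Fm → Fm
  layer e es = e ∧' (□ ⋁ es ∧' ⋀ (map ◇_ es))

  types : ℕ → List Fm
  types zero = map ⋀ (sublists signed-atoms)
  types (suc i) = cartesianProductWith layer (types i) (sublists (types i))

  types-zero⁻ : ∀ {e} → e ∈ types 0 →
    Σ (List Fm) λ es → e ≡ ⋀ es × (∀ {a} → a ∈ es → a ∈ signed-atoms)
  types-zero⁻ i with ∈-map⁻ ⋀ i
  ... | es , j , eq = es , eq , sublists-⊆ signed-atoms j

  types-suc⁻ : ∀ i {e} → e ∈ types (suc i) →
    Σ Fm λ e' → Σ (List Fm) λ es → e ≡ layer e' es × e' ∈ types i × (∀ {a} → a ∈ es → a ∈ types i)
  types-suc⁻ i j with ∈-cartesianProductWith⁻ layer (types i) (sublists (types i)) j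
  ... | e' , es , l , m , eq = e' , es , eq , l , sublists-⊆ (types i) m

  signed-atoms-polarised : ∀ {a} → a ∈ signed-atoms → Polarised (_∈ neg) (_∈ pos) a
  signed-atoms-polarised i with ∈-++⁻ (map (¬' ∘ var) pos) i
  ... | inj₁ j with ∈-map⁻ (¬' ∘ var) j
  ...   | p , l , refl = l , tt
  signed-atoms-polarised i | inj₂ j with ∈-map⁻ var j
  ...   | p , l , refl = l

  types-polarised : ∀ i {e} → e ∈ types i → Polarised (_∈ neg) (_∈ pos) e
  types-polarised zero j with types-zero⁻ j
  ... | es , refl , f = polarised-⋀ es (signed-atoms-polarised ∘ f)
  types-polarised (suc i) j with types-suc⁻ i j
  ... | e' , es , refl , l , f =
    ( types-polarised i l
    , (((polarised-⋁ es (types-polarised i ∘ f)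
        , polarised-⋀ (map ◇_ es) diamonds , tt) , tt) , tt)) , tt
    where
    diamonds : ∀ {a} → a ∈ map ◇_ es → Polarised (_∈ neg) (_∈ pos) a
    diamonds q with ∈-map⁻ ◇_ q
    ... | a , q' , refl = (types-polarised i (f q') , tt) , tt

  types-depth : ∀ i {e} → e ∈ types i → d e ≤ i
  types-depth zero j with types-zero⁻ j
  ... | es , refl , f = d-⋀ es (atom-depth ∘ f)
    where
    atom-depth : ∀ {a} → a ∈ signed-atoms → d a ≤ 0
    atom-depth q with ∈-++⁻ (map (¬' ∘ var) pos) q
    ... | inj₁ q' with ∈-map⁻ (¬' ∘ var) q'
    ...   | p , l , refl = z≤n
    atom-depth q | inj₂ q' with ∈-map⁻ var q'
    ...   | p , l , refl = z≤n
  types-depth (suc i) j with types-suc⁻ i j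
  ... | e' , es , refl , l , f =
    ⊔-lub (⊔-lub (m≤n⇒m≤1+n (types-depth i l))
      (⊔-lub (⊔-lub (⊔-lub (s≤s (d-⋁ es (types-depth i ∘ f)))
                      (⊔-lub (d-⋀ (map ◇_ es) diamonds) z≤n)) z≤n) z≤n)) z≤n
    where
    diamonds : ∀ {a} → a ∈ map ◇_ es → d a ≤ suc i
    diamonds q with ∈-map⁻ ◇_ q
    ... | a , q' , refl = ⊔-lub (s≤s (⊔-lub (types-depth i (f q')) z≤n)) z≤n

  Characterises : ℕ → Tree → Fm → Set
  Characterises i t e = t ⊩ e × (∀ {s} → s ⊩ e → s ≼[ i ] t)

  -- In the step, `es` collects types of all subtrees of `t`: the box confines the subtrees of `s`
  -- to them, and the diamonds make each of them occur, which gives the two halves of the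
  -- simulation.
  characteristic : ∀ i t → Σ Fm λ e → e ∈ types i × Characterises i t e
  characteristic zero t = ⋀ es , ∈-map⁺ ⋀ es∈
    , ⋀⁺ (λ i → let (a , j , eq) = proj₂ cov i in
                ≡-subst (t ⊩_) eq (proj₂ (∈-filter⁻ (t ⊩?_) {xs = signed-atoms} j)))
    , λ {s} x →
        (λ {p} i y → by-contradiction λ n → ¬⁻ (⋀⁻ x (included
            (∈-++⁺ˡ (∈-map⁺ (¬' ∘ var) i)) (¬⁺ n))) y)
      , (λ {p} i y → ⋀⁻ x (included (∈-++⁺ʳ (map (¬' ∘ var) pos) (∈-map⁺ var i)) y))
    where
    chosen = cover {R = _≡_} signed-atoms (filter (t ⊩?_) signed-atoms)
      λ {x} i → x , proj₁ (∈-filter⁻ (t ⊩?_) i) , refl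
    es = proj₁ chosen
    es∈ = proj₁ (proj₂ chosen)
    cov = proj₂ (proj₂ chosen)
    included : ∀ {a} → a ∈ signed-atoms → t ⊩ a → a ∈ es
    included i x with proj₁ cov (∈-filter⁺ (t ⊩?_) i x)
    ... | _ , j , refl = j
  characteristic (suc i) t = layer e es
    , ∈-cartesianProductWith⁺ layer e∈ es∈
    , ∧'⁺ (proj₁ ch) (∧'⁺
        (□⁺ λ p → let (_ , j , x , _) = proj₁ cov (subtrees⁺ p) in ⋁⁺ j x)
        (⋀⁺ diamonds))
    , λ {s} x → let (x₁ , x₂₃) = ∧'⁻ x ; (x₂ , x₃) = ∧'⁻ x₂₃ in
        proj₂ ch x₁
      , (λ p → let (_ , j , y) = ⋁⁻ (□⁻ x₂ p) ; (t' , q , _ , f) = proj₂ cov j in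
               t' , subtrees⁻ t q , f y)
      , (λ p → let (_ , j , _ , f) = proj₁ cov (subtrees⁺ p)
                   (s' , q , y) = ◇⁻ (⋀⁻ x₃ (∈-map⁺ ◇_ j)) in
               s' , q , f y)
    where
    root-type = characteristic i t
    e = proj₁ root-type
    e∈ = proj₁ (proj₂ root-type)
    ch = proj₂ (proj₂ root-type)
    chosen = cover {R = Characterises i} (types i) (subtrees t) λ {s} _ → characteristic i s
    es = proj₁ chosen
    es∈ = proj₁ (proj₂ chosen)
    cov = proj₂ (proj₂ chosen)
    diamonds : ∀ {a} → a ∈ map ◇_ es → t ⊩ a
    diamonds j with ∈-map⁻ ◇_ j
    ... | _ , j' , refl = let (_ , q , x , _) = proj₂ cov j' in ◇⁺ (subtrees⁻ t q) x

-- Amalgamation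

module _ {X : Set} {P Q : X → Set} (P? : ∀ x → Dec (P x)) (Q? : ∀ x → Dec (Q x)) where

  length-filter-mono-≤ : ∀ xs → (∀ {x} → x ∈ xs → P x → Q x) →
    length (filter P? xs) ≤ length (filter Q? xs)
  length-filter-mono-≤ [] f = z≤n
  length-filter-mono-≤ (x ∷ xs) f with P? x | Q? x | length-filter-mono-≤ xs (f ∘ there)
  ... | yes _ | yes _ | ih = s≤s ih
  ... | yes p | no nq | ih = ⊥-elim (nq (f (here refl) p))
  ... | no _ | yes _ | ih = m≤n⇒m≤1+n ih
  ... | no _ | no _ | ih = ih

  length-filter-mono-< : ∀ {x} xs → (∀ {x} → x ∈ xs → P x → Q x) → x ∈ xs → ¬ P x → Q x →
    length (filter P? xs) < length (filter Q? xs)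
  length-filter-mono-< (x ∷ xs) f (here refl) np q
    with P? x | Q? x | length-filter-mono-≤ xs (f ∘ there)
  ... | yes p | _ | _ = ⊥-elim (np p)
  ... | no _ | no nq | _ = ⊥-elim (nq q)
  ... | no _ | yes _ | le = s≤s le
  length-filter-mono-< (x ∷ xs) f (there i) np q
    with P? x | Q? x | length-filter-mono-< xs (f ∘ there) i np q
  ... | yes _ | yes _ | ih = s≤s ih
  ... | yes p | no nq | ih = ⊥-elim (nq (f (here refl) p))
  ... | no _ | yes _ | ih = m≤n⇒m≤1+n ih
  ... | no _ | no _ | ih = ih

mutual
  size : Tree → ℕ
  size (node v ts) = suc (sizes ts)

  sizes : List Tree → ℕ
  sizes [] = 0
  sizes (t ∷ ts) = size t + sizes ts

size-∈ : ∀ {t ts} → t ∈ ts → size t ≤ sizes ts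
size-∈ {ts = t ∷ ts} (here refl) = m≤m+n (size t) (sizes ts)
size-∈ {ts = t ∷ ts} (there i) = ≤-trans (size-∈ i) (m≤n+m (sizes ts) (size t))

size-child : ∀ {c t} → c ∈ children t → size c < size t
size-child {t = node _ _} i = s≤s (size-∈ i)

size-⊑ : ∀ {s t} → s ⊑ t → size s ≤ size t
size-⊑ root = ≤-refl
size-⊑ (below i p) = ≤-trans (size-⊑ p) (<⇒≤ (size-child i))

-- The existential conditions are skolemised, to keep the recursion on derivations structural.
data LyndonBisimilar (A B : ℕ → Set) : Tree → Tree → Set where
  lyndon : ∀ {x t} →
    (∀ {p} → A p → x ⊩ var p → t ⊩ var p) →
    (∀ {p} → B p → t ⊩ var p → x ⊩ var p) →
    (forth : ∀ {y} → y ∈ children x → Tree) →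
    (∀ {y} (i : y ∈ children x) → forth i ⊑ t) →
    (∀ {y} (i : y ∈ children x) → LyndonBisimilar A B y (forth i)) →
    (back : ∀ {t'} → t' ∈ children t → Tree) →
    (∀ {t'} (i : t' ∈ children t) → back i ∈ children x) →
    (∀ {t'} (i : t' ∈ children t) → LyndonBisimilar A B (back i) t') →
    LyndonBisimilar A B x t

-- A child of `x` may be matched with any subtree of `t`, because `□ a` is inherited by all
-- subtrees.
lyndon-transfer : ∀ {A B x t} → LyndonBisimilar A B x t → ∀ a →
  (Polarised A B a → x ⊩ a → t ⊩ a) × (Polarised B A a → t ⊩ a → x ⊩ a)
lyndon-transfer (lyndon α β _ _ _ _ _ _) (var p) = α , β
lyndon-transfer (lyndon _ _ _ _ _ _ _ _) ⊥' = (λ _ → ⊥-elim ∘ ⊨⊥) , (λ _ → ⊥-elim ∘ ⊨⊥)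
lyndon-transfer z (a ⇒ b) =
    (λ (pa , pb) e → ⇒⁺ λ u → proj₁ (lyndon-transfer z b) pb
                       (⇒⁻ e (proj₂ (lyndon-transfer z a) pa u)))
  , (λ (pa , pb) e → ⇒⁺ λ u → proj₂ (lyndon-transfer z b) pb
                       (⇒⁻ e (proj₁ (lyndon-transfer z a) pa u)))
lyndon-transfer z@(lyndon _ _ forth forth⊑ f back back∈ g) (□ a) =
    (λ pa e → □-intro (proj₁ (lyndon-transfer z a) pa (□-root e)) λ i →
        proj₁ (lyndon-transfer (g i) (□ a)) pa (□-child e (back∈ i)))
  , (λ pa e → □-intro (proj₂ (lyndon-transfer z a) pa (□-root e)) λ i →
        proj₂ (lyndon-transfer (f i) (□ a)) pa (□-⊑ e (forth⊑ i)))

module Amalgamation (φ : Fm) (P Q : List ℕ) where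

  B : List Fm
  B = deduplicateᵇ _==_ (boxedSubs φ)

  boxedSubs⊆B : ∀ {b} → b ∈ boxedSubs φ → b ∈ B
  boxedSubs⊆B = ∈-deduplicate⁺ (≡-setoid Fm) (λ a b → T? (a == b))
    λ {_} {y} {z} e eq → trans eq (sym (==-sound z y (Equivalence.to T-≡ e)))

  pos neg : List ℕ
  pos = filter (_∉? P) (v⁺ φ)
  neg = filter (_∉? Q) (v⁻ φ)

  open Layers pos neg public

  infix 4 _≽_
  -- Weaker than accessibility: children of an amalgam may realise points outside the subtree `s`,
  -- provided that the boxes true at `s` persist.
  _≽_ : Tree → Tree → Set
  t ≽ s = ∀ {b} → b ∈ B → s ⊩ □ b → t ⊩ □ b

  ≽-⊑ : ∀ {s t} → s ⊑ t → s ≽ t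
  ≽-⊑ p _ e = □-⊑ e p

  refutes? : ∀ t b → Dec (¬ t ⊩ □ b)
  refutes? t b = ¬? (t ⊩? (□ b))

  rank : Tree → ℕ
  rank t = length (filter (refutes? t) B)

  rank-≤ : ∀ {s t} → t ≽ s → rank t ≤ rank s
  rank-≤ le = length-filter-mono-≤ (refutes? _) (refutes? _) B λ i n e → n (le i e)

  rank-< : ∀ {s t b} → t ≽ s → b ∈ B → t ⊩ □ b → ¬ s ⊩ □ b → rank t < rank s
  rank-< le i x nx = length-filter-mono-< (refutes? _) (refutes? _) B
    (λ i n e → n (le i e)) i (λ n → n x) nx

  rank-<-or-≽ : ∀ {s t} → t ≽ s → rank t < rank s ⊎ s ≽ t
  rank-<-or-≽ {s} {t} le with all-or {P = λ b → t ⊩ □ b → s ⊩ □ b} B (λ {b} i → decide b i)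
    where
    decide : ∀ b → b ∈ B → (t ⊩ □ b → s ⊩ □ b) ⊎ rank t < rank s
    decide b i with t ⊩? (□ b) | s ⊩? (□ b)
    ... | _ | yes y = inj₁ λ _ → y
    ... | no n | no _ = inj₁ (⊥-elim ∘ n)
    ... | yes x | no n = inj₂ (rank-< le i x n)
  ... | inj₁ f = inj₂ f
  ... | inj₂ lt = inj₁ lt

  -- x realises the truth values of the subformulas of φ at s, up to polarity.
  data Realises : Tree → Tree → Set where
    realises : ∀ {x s} →
      (∀ {p} → p ∈ v⁺ φ → s ⊩ var p → x ⊩ var p) →
      (∀ {p} → p ∈ v⁻ φ → x ⊩ var p → s ⊩ var p) →
      (forth : ∀ {y} → y ∈ children x → Tree) →
      (∀ {y} (i : y ∈ children x) → forth i ≽ s) →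
      (∀ {y} (i : y ∈ children x) → Realises y (forth i)) →
      (back witness : ∀ {b} → b ∈ B → s ⊩ b → ¬ s ⊩ □ b → Tree) →
      (∀ {b} (i : b ∈ B) u n → back i u n ∈ children x × ¬ witness i u n ⊩ b) →
      (∀ {b} (i : b ∈ B) u n → Realises (back i u n) (witness i u n)) →
      Realises x s

  -- True boxes persist along `≽`. If `x` satisfies `□ a` but `s` does not, then `a` holds at `s`,
  -- so a child of `x` realises a witness refuting `a`; but `a` holds at that child, a
  -- contradiction.
  realises-transfer : ∀ {x s} → Realises x s → ∀ a → (∀ {b} → b ∈ boxedSubs a → b ∈ B) →
    (Polarised (_∈ v⁺ φ) (_∈ v⁻ φ) a → s ⊩ a → x ⊩ a) ×
    (Polarised (_∈ v⁻ φ) (_∈ v⁺ φ) a → x ⊩ a → s ⊩ a)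
  realises-transfer (realises α β _ _ _ _ _ _ _) (var p) sub = α , β
  realises-transfer (realises _ _ _ _ _ _ _ _ _) ⊥' sub =
    (λ _ → ⊥-elim ∘ ⊨⊥) , (λ _ → ⊥-elim ∘ ⊨⊥)
  realises-transfer r (a ⇒ b) sub =
      (λ (pa , pb) e → ⇒⁺ λ u → proj₁ (realises-transfer r b (sub ∘ ∈-++⁺ʳ (boxedSubs a))) pb
         (⇒⁻ e (proj₂ (realises-transfer r a (sub ∘ ∈-++⁺ˡ)) pa u)))
    , (λ (pa , pb) e → ⇒⁺ λ u → proj₂ (realises-transfer r b (sub ∘ ∈-++⁺ʳ (boxedSubs a))) pb
         (⇒⁻ e (proj₁ (realises-transfer r a (sub ∘ ∈-++⁺ˡ)) pa u)))
  realises-transfer r@(realises _ _ forth forth≽ f back witness back-ok g) (□ a) sub =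
      (λ pa e → □-intro (proj₁ (realises-transfer r a (sub ∘ there)) pa (□-root e)) λ i →
         proj₁ (realises-transfer (f i) (□ a) sub) pa (forth≽ i (sub (here refl)) e))
    , (λ pa e → by-contradiction λ n →
         let u = proj₂ (realises-transfer r a (sub ∘ there)) pa (□-root e)
             (i , nw) = back-ok (sub (here refl)) u n in
         nw (proj₂ (realises-transfer (g (sub (here refl)) u n) a (sub ∘ there)) pa
              (□-root (□-child e i))))

  Amalgam : Tree → Tree → Set
  Amalgam s t = Σ Tree λ x → Realises x s × LyndonBisimilar (_∉ P) (_∉ Q) x t

  needy? : ∀ s b → Dec (s ⊩ b × ¬ s ⊩ □ b)
  needy? s b = s ⊩? b ×-dec refutes? s b

  -- Children from `jump` refute what `s` needs refuted, those from `back` match the children of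
  -- `t`. Each is an amalgam of some `s' ≽ s` with a subtree of `t`, so it is admissible for both
  -- relations.
  assemble : ∀ s t → s ≼[ 0 ] t →
    (∀ {b} → b ∈ B → s ⊩ b → ¬ s ⊩ □ b → Σ Tree λ s' → Σ Tree λ t' →
      s' ≽ s × ¬ s' ⊩ b × t' ⊑ t × Amalgam s' t') →
    (∀ {t'} → t' ∈ children t → Σ Tree λ s' → s' ≽ s × Amalgam s' t') →
    Amalgam s t
  assemble s t (s≼t , t≼s) jump back = x
    , realises s≤x x≤s (proj₁ ∘ x⇝s) (λ i → proj₁ (proj₂ (x⇝s i))) (λ i → proj₂ (proj₂ (x⇝s i)))
        (λ i u n → proj₁ (s⇝x i u n)) (λ i u n → proj₁ (proj₂ (s⇝x i u n)))
        (λ i u n → proj₁ (proj₂ (proj₂ (s⇝x i u n)))) (λ i u n → proj₂ (proj₂ (proj₂ (s⇝x i u n))))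
    , lyndon x≤t t≤x (proj₁ ∘ x⇝t) (λ i → proj₁ (proj₂ (x⇝t i))) (λ i → proj₂ (proj₂ (x⇝t i)))
        (proj₁ ∘ t⇝x) (λ i → proj₁ (proj₂ (t⇝x i))) (λ i → proj₂ (proj₂ (t⇝x i)))
    where
    Jump : Fm → Tree → Set
    Jump b y = Σ Tree λ s' → Σ Tree λ t' →
      s' ≽ s × ¬ s' ⊩ b × t' ⊑ t × Realises y s' × LyndonBisimilar (_∉ P) (_∉ Q) y t'
    Back : Tree → Tree → Set
    Back t' y = Σ Tree λ s' → s' ≽ s × Realises y s' × LyndonBisimilar (_∉ P) (_∉ Q) y t'

    needy : List Fm
    needy = filter (needy? s) B

    jumps : Σ (List Tree) (Covers Jump needy)
    jumps = collect needy λ i →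
      let (j , u , n) = ∈-filter⁻ (needy? s) {xs = B} i
          (s' , t' , le , m , p , y , r , l) = jump j u n in
      y , s' , t' , le , m , p , r , l
    backs : Σ (List Tree) (Covers Back (children t))
    backs = collect (children t) λ i →
      let (s' , le , y , r , l) = back i in y , s' , le , r , l

    -- The join of the lower bounds imposed on x: s on v⁺ φ and t off Q.
    x : Tree
    x = node (λ p → (does (p ∈? v⁺ φ) ∧ val s p) ∨ (does (p ∉? Q) ∧ val t p))
             (proj₁ jumps ++ proj₁ backs)

    s≤x : ∀ {p} → p ∈ v⁺ φ → s ⊩ var p → x ⊩ var p
    s≤x {p} i ⟨ e ⟩ = ⟨ ∨⁺ˡ (∧⁺ (dec-true (p ∈? v⁺ φ) i) e) ⟩
    t≤x : ∀ {p} → p ∉ Q → t ⊩ var p → x ⊩ var p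
    t≤x {p} n ⟨ e ⟩ = ⟨ ∨⁺ʳ _ (∧⁺ (dec-true (p ∉? Q) n) e) ⟩
    x-var : ∀ {p} → x ⊩ var p → (p ∈ v⁺ φ × s ⊩ var p) ⊎ (p ∉ Q × t ⊩ var p)
    x-var {p} ⟨ e ⟩ with ∨⁻ {does (p ∈? v⁺ φ) ∧ val s p} e
    ... | inj₁ u = inj₁ (does-true (p ∈? v⁺ φ) (proj₁ (∧⁻ u)) ,
                         ⟨ proj₂ (∧⁻ {does (p ∈? v⁺ φ)} u) ⟩)
    ... | inj₂ u = inj₂ (does-true (p ∉? Q) (proj₁ (∧⁻ u)) , ⟨ proj₂ (∧⁻ {does (p ∉? Q)} u) ⟩)
    x≤s : ∀ {p} → p ∈ v⁻ φ → x ⊩ var p → s ⊩ var p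
    x≤s i e with x-var e
    ... | inj₁ (_ , u) = u
    -- A variable taken from `t` lies outside `Q`; being in `v⁻ φ` it belongs to `neg`, hence is
    -- true at `s` as well.
    ... | inj₂ (n , u) = t≼s (∈-filter⁺ (_∉? Q) i n) u
    x≤t : ∀ {p} → p ∉ P → x ⊩ var p → t ⊩ var p
    x≤t n e with x-var e
    ... | inj₁ (i , u) = s≼t (∈-filter⁺ (_∉? P) i n) u
    ... | inj₂ (_ , u) = u

    x⇝s : ∀ {y} → y ∈ children x → Σ Tree λ s' → s' ≽ s × Realises y s'
    x⇝s i with ∈-++⁻ (proj₁ jumps) i
    ... | inj₁ j = let (_ , _ , s' , _ , le , _ , _ , r , _) = proj₂ (proj₂ jumps) j in s' , le , r
    ... | inj₂ j = let (_ , _ , s' , le , r , _) = proj₂ (proj₂ backs) j in s' , le , r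
    s⇝x : ∀ {b} → b ∈ B → s ⊩ b → ¬ s ⊩ □ b →
      Σ Tree λ y → Σ Tree λ s' → (y ∈ children x × ¬ s' ⊩ b) × Realises y s'
    s⇝x i u n =
      let (y , j , s' , _ , _ , m , _ , r , _) =
            proj₁ (proj₂ jumps) (∈-filter⁺ (needy? s) i (u , n)) in
      y , s' , (∈-++⁺ˡ j , m) , r
    x⇝t : ∀ {y} → y ∈ children x → Σ Tree λ t' → t' ⊑ t × LyndonBisimilar (_∉ P) (_∉ Q) y t'
    x⇝t i with ∈-++⁻ (proj₁ jumps) i
    ... | inj₁ j = let (_ , _ , _ , t' , _ , _ , p , _ , l) = proj₂ (proj₂ jumps) j in t' , p , l
    ... | inj₂ j = let (t' , q , _ , _ , _ , l) = proj₂ (proj₂ backs) j in t' , below q root , l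
    t⇝x : ∀ {t'} → t' ∈ children t →
      Σ Tree λ y → y ∈ children x × LyndonBisimilar (_∉ P) (_∉ Q) y t'
    t⇝x i = let (y , j , _ , _ , _ , l) = proj₁ (proj₂ backs) i in
      y , ∈-++⁺ʳ (proj₁ jumps) j , l

  -- Here `□ b` fails at `s` but holds at every proper subtree, so any move to one lowers the rank.
  Last : Tree → Set
  Last s = Σ Fm λ b → b ∈ B × LastRefuting b s

  -- s₀ ≼ t₀ is the pair from which successors matching the children of t are taken; it keeps one
  -- layer more than s ≼ t, so that these moves cost nothing as long as the rank stays the same.
  mutual
    start : ∀ H s t → s ≼[ 3 + H * 3 ] t → rank s ≤ H → Amalgam s t
    -- The pair becomes its own remembered pair; the copy in play gives up one layer. The size of
    -- `t` is the fuel for moves to its children.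
    start H s t st r = ordinary H (size t) ≤-refl st root (λ _ e → e) r (proj₁ st)

    -- `suc H * 3` unfolds to `3 + H * 3`, so the layers left after a fall of the rank are exactly
    -- those `start` requires at the smaller bound.
    descend : ∀ H s t → s ≼[ H * 3 ] t → rank s < H → Amalgam s t
    descend (suc H) s t st (s≤s r) = start H s t st r

    ordinary : ∀ H f {s₀ t₀ s t} → size t ≤ f → s₀ ≼[ 3 + H * 3 ] t₀ → t ⊑ t₀ → s₀ ≽ s →
      rank s ≤ H → s ≼[ 2 + H * 3 ] t → Amalgam s t
    ordinary H f {s₀} {t₀} {s} {t} sz st₀ t⊑t₀ s₀≽s r st =
      assemble s t (≼-atoms (2 + H * 3) st) jump (successor H f sz st₀ t⊑t₀ s₀≽s r)
      where
      jump : ∀ {b} → b ∈ B → s ⊩ b → ¬ s ⊩ □ b → Σ Tree λ s' → Σ Tree λ t' →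
        s' ≽ s × ¬ s' ⊩ b × t' ⊑ t × Amalgam s' t'
      jump {b} i _ n with last-refuting n
      ... | s' , p , l with proj₁ (proj₂ st) p
      ...   | t' , q , st' = s' , t' , ≽-⊑ p , proj₁ l , q , amalgam
        where
        amalgam : Amalgam s' t'
        amalgam with rank-<-or-≽ (≽-⊑ p)
        ... | inj₁ lt = descend H s' t' (proj₁ st') (≤-trans lt r)
        -- No new box is true at `s'`, so the remembered pair still fits; and `s'` is last for `b`,
        -- which makes the next jump lower the rank.
        ... | inj₂ ge = maximal H f (≤-trans (size-⊑ q) sz) st₀ (⊑-trans q t⊑t₀)
          (λ i e → s₀≽s i (ge i e)) (≤-trans (rank-≤ (≽-⊑ p)) r) st' (b , i , l)

    maximal : ∀ H f {s₀ t₀ s t} → size t ≤ f → s₀ ≼[ 3 + H * 3 ] t₀ → t ⊑ t₀ → s₀ ≽ s →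
      rank s ≤ H → s ≼[ 1 + H * 3 ] t → Last s → Amalgam s t
    maximal H f {s₀} {t₀} {s} {t} sz st₀ t⊑t₀ s₀≽s r st (c , c∈ , nc , after) =
      assemble s t (≼-atoms (1 + H * 3) st) jump (successor H f sz st₀ t⊑t₀ s₀≽s r)
      where
      jump : ∀ {b} → b ∈ B → s ⊩ b → ¬ s ⊩ □ b → Σ Tree λ s' → Σ Tree λ t' →
        s' ≽ s × ¬ s' ⊩ b × t' ⊑ t × Amalgam s' t'
      jump {b} i u n with last-refuting n
      -- The jump cannot stay at `s`, where `b` holds; at a proper subtree `□ c` becomes true, as
      -- `s` is last for `c`.
      ... | s' , root , m , _ = ⊥-elim (m u)
      ... | s' , p@(below j p') , m , _ with proj₁ (proj₂ st) p
      ...   | t' , q , st' = s' , t' , ≽-⊑ p , m , q , descend H s' t' st'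
        (≤-trans (rank-< (≽-⊑ p) c∈ (□-⊑ (after j) p') (nc ∘ □-root)) r)

    -- The match is sought below `s₀`, not `s`: by transitivity of `⊑` the remembered pair answers
    -- at any depth of `t` without losing layers, and `s₀ ≽ s` still yields `s' ≽ s`.
    successor : ∀ H f {s₀ t₀ s t} → size t ≤ f → s₀ ≼[ 3 + H * 3 ] t₀ → t ⊑ t₀ → s₀ ≽ s →
      rank s ≤ H → ∀ {t'} → t' ∈ children t → Σ Tree λ s' → s' ≽ s × Amalgam s' t'
    successor H zero {t = node _ _} ()
    successor H (suc f) {s₀} {t₀} {s} {t} sz st₀ t⊑t₀ s₀≽s r {t'} i
      with proj₂ (proj₂ st₀) (⊑-trans (below i root) t⊑t₀)
    ... | s' , p , st' = s' , (λ j e → ≽-⊑ p j (s₀≽s j e)) , amalgam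
      where
      amalgam : Amalgam s' t'
      amalgam with rank-<-or-≽ (≽-⊑ p)
      ... | inj₁ lt = descend H s' t' (proj₁ (proj₁ st')) (≤-trans lt (≤-trans (rank-≤ s₀≽s) r))
      ... | inj₂ ge = ordinary H f (≤-pred (≤-trans (size-child i) sz)) st₀
        (⊑-trans (below i root) t⊑t₀) ge
        (≤-trans (rank-≤ (≽-⊑ p)) (≤-trans (rank-≤ s₀≽s) r)) st'

  amalgamate : ∀ {s t} → s ≼[ 3 + n φ * 3 ] t → Amalgam s t
  amalgamate {s} {t} st = start (n φ) s t st (length-filter (refutes? s) B)

  -- The interpolant and its depth

  module Interpolant (depth : ℕ) (amalgamate : ∀ {s t} → s ≼[ depth ] t → Amalgam s t) where

    Implied : Fm → Set
    Implied e = Grz⊢ (φ ⇒ ¬' e)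

    -- Completeness settles for each type whether `φ` implies its negation, and otherwise supplies
    -- the tree to be amalgamated.
    decide : ∀ es → Σ (List Fm) λ θs →
      (∀ {a} → a ∈ θs → Σ Fm λ e → a ≡ ¬' e × e ∈ es × Implied e) ×
      (∀ {e} → e ∈ es → ¬' e ∈ θs ⊎ Σ Tree λ s → ¬ s ⊩ (φ ⇒ ¬' e))
    decide [] = [] , (λ ()) , (λ ())
    decide (e ∷ es) with decide es | complete (φ ⇒ ¬' e)
    ... | θs , f , g | inj₁ p = ¬' e ∷ θs
      , (λ { (here refl) → e , refl , here refl , p
           ; (there i) → let (e' , eq , j , q) = f i in e' , eq , there j , q })
      , (λ { (here refl) → inj₁ (here refl)
           ; (there i) → [ inj₁ ∘ there , inj₂ ]′ (g i) })
    ... | θs , f , g | inj₂ s = θs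
      , (λ i → let (e' , eq , j , q) = f i in e' , eq , there j , q)
      , (λ { (here refl) → inj₂ s ; (there i) → g i })

    conjuncts : List Fm
    conjuncts = proj₁ (decide (types depth))

    conjunct⁻ : ∀ {a} → a ∈ conjuncts → Σ Fm λ e → a ≡ ¬' e × e ∈ types depth × Implied e
    conjunct⁻ = proj₁ (proj₂ (decide (types depth)))

    conjunct⁺ : ∀ {e} → e ∈ types depth → ¬' e ∈ conjuncts ⊎ Σ Tree λ s → ¬ s ⊩ (φ ⇒ ¬' e)
    conjunct⁺ = proj₂ (proj₂ (decide (types depth)))

    interpolant : Fm
    interpolant = ⋀ conjuncts

    interpolant-polarised : Polarised (_∈ pos) (_∈ neg) interpolant
    interpolant-polarised = polarised-⋀ conjuncts λ i → conjunct-polarised (conjunct⁻ i)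
      where
      conjunct-polarised : ∀ {a} → Σ Fm (λ e → a ≡ ¬' e × e ∈ types depth × Implied e) →
        Polarised (_∈ pos) (_∈ neg) a
      conjunct-polarised (_ , refl , i , _) = types-polarised depth i , tt

    interpolant-depth : d interpolant ≤ depth
    interpolant-depth = d-⋀ conjuncts λ i → conjunct-depth (conjunct⁻ i)
      where
      conjunct-depth : ∀ {a} → Σ Fm (λ e → a ≡ ¬' e × e ∈ types depth × Implied e) → d a ≤ depth
      conjunct-depth (_ , refl , i , _) = ⊔-lub (types-depth depth i) z≤n

    implies-interpolant : Grz⊢ (φ ⇒ interpolant)
    implies-interpolant = consequence (map (φ ⇒_) conjuncts) premises λ V as →
      E.⇒⁺ λ u → E.⋀⁺ λ i → E.⇒⁻ (as (∈-map⁺ (φ ⇒_) i)) u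
      where
      premises : ∀ {h} → h ∈ map (φ ⇒_) conjuncts → Grz⊢ h
      premises i with ∈-map⁻ (φ ⇒_) i
      ... | _ , j , refl with conjunct⁻ j
      ...   | _ , refl , _ , p = p

    interpolant-implies : ∀ ψ → Polarised (_∉ P) (_∉ Q) ψ → Grz⊢ (φ ⇒ ψ) → Grz⊢ (interpolant ⇒ ψ)
    interpolant-implies ψ polψ φ⇒ψ with complete (interpolant ⇒ ψ)
    ... | inj₁ p = p
    ... | inj₂ (t , nt) = ⊥-elim (nt (⇒⁺ λ t⊩θ → t⊩ψ t⊩θ))
      where
      t⊩ψ : t ⊩ interpolant → t ⊩ ψ
      t⊩ψ t⊩θ with characteristic depth t
      ... | e , e∈ , t⊩e , f with conjunct⁺ e∈
      -- `t` satisfies its own type, so the interpolant cannot contain its negation.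
      ...   | inj₁ i = ⊥-elim (¬⁻ (⋀⁻ t⊩θ i) t⊩e)
      ...   | inj₂ (s , ns) with amalgamate (f (by-contradiction λ ne → ns (⇒⁺ λ _ → ¬⁺ ne)))
      ...     | x , r , l = proj₁ (lyndon-transfer l ψ) polψ (⇒⁻ (sound φ⇒ψ x) x⊩φ)
        where
        s⊩φ : s ⊩ φ
        s⊩φ = by-contradiction λ nφ → ns (⇒⁺ (⊥-elim ∘ nφ))
        x⊩φ : x ⊩ φ
        x⊩φ = proj₁ (realises-transfer r φ boxedSubs⊆B) (polarised⁺ φ id id) s⊩φ

    isULI : IsULI φ P Q interpolant
    isULI = (λ i → ∈-filter⁻ (_∉? P) {xs = v⁺ φ} (proj₁ vars i))
          , (λ i → ∈-filter⁻ (_∉? Q) {xs = v⁻ φ} (proj₂ vars i))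
          , implies-interpolant
          , λ ψ f g → interpolant-implies ψ (polarised⁺ ψ f g)
      where
      vars = polarised⁻ interpolant interpolant-polarised

uniform-interpolant : ∀ φ P Q → Σ Fm (λ θ → IsULI φ P Q θ × d θ ≤ 3 * n φ + 3)
uniform-interpolant φ P Q = with-depth (3 * n φ + 3)
  (trans (+-comm (3 * n φ) 3) (cong (3 +_) (*-comm 3 (n φ))))
  where
  open Amalgamation φ P Q
  -- With the depth generalised, the arithmetic identity acts on the simulation only and leaves the
  -- depth bound as stated.
  with-depth : ∀ i → i ≡ 3 + n φ * 3 → Σ Fm (λ θ → IsULI φ P Q θ × d θ ≤ i)
  with-depth i eq = interpolant , isULI , interpolant-depth
    where
    open Interpolant i (λ {s} {t} st → amalgamate (≡-subst (λ j → s ≼[ j ] t) eq st))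

theorem5p3 : GrzULIP ×
    ((φ : Fm) (P Q : List ℕ) → Σ Fm (λ θ → IsULI φ P Q θ × d θ ≤ 3 * n φ + 3))
theorem5p3 =
    (λ φ P Q → let (θ , uli , _) = uniform-interpolant φ P Q in θ , uli)
  , uniform-interpolant
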